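{- Let $L$ be a symmetric Latin square of order $n$ and let $\Gamma$ be its rrs-autotopism group. Then the number of isomorphism classes of symmetric Latin squares that are rrs-isotopic to $L$ equals \[\frac{1}{|\Gamma|}\sum_{(\alpha,\alpha,\beta)\in\Gamma}\psi(\alpha,\beta),\] where $\psi(\alpha,\beta)=\prod_{i=1}^k (n_i)!\,c_i^{n_i}$ if $\alpha$ and $\beta$ have the same cycle structure $c_1^{n_1}\cdots c_k^{n_k}$ (i.e. $n_i$ cycles of length $c_i$, with distinct $c_i$, fixed points counted as cycles of length 1), and $\psi(\alpha,\beta)=0$ otherwise.
   Context: A Latin square of order $n$ is a set of $n^2$ triples (row, column, symbol) over $\{1,\dots,n\}$, distinct triples agreeing in at most one coordinate; it is symmetric if it equals its transpose. An isotopism $(\alpha,\beta,\gamma)\in\mathcal{S}_n^3$ maps $(r,c,s)$ to $(r^\alpha,c^\beta,s^\gamma)$; it is an rrs-isotopism if $\alpha=\beta$ and an isomorphism if $\alpha=\beta=\gamma$. The rrs-autotopism group of $L$ is the group of rrs-isotopisms mapping $L$ to itself. -}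

module Defs where

open import Data.Nat using (ℕ; zero; suc; _*_; _^_; _/_)
open import Data.Nat using (_!)
open import Data.Nat.ListAction using (product; sum)
open import Data.Fin using (Fin)
open import Data.Fin.Properties using (_≟_; all?)
open import Data.Fin.Permutation using (Permutation′; _⟨$⟩ʳ_)
open import Data.Vec using (Vec; []; _∷_; lookup)
open import Data.List using (List; []; _∷_; [_]; map; concatMap; filter; length; upTo; allFin; cartesianProduct)
open import Data.List.Relation.Unary.All using (All)
open import Data.List.Relation.Unary.Any using (Any)
open import Data.List.Relation.Unary.AllPairs using (AllPairs)
open import Data.Product using (Σ; ∃; _×_; _,_; proj₁; proj₂)
open import Data.Bool using (Bool; true; false; if_then_else_)
open import Relation.Nullary using (¬_; Dec; yes; no; _×-dec_; _→-dec_)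
open import Relation.Nullary.Decidable using (⌊_⌋)
import Data.Nat.Properties as ℕP
open import Relation.Binary.PropositionalEquality using (_≡_)

-- Latin squares of order n, given as the function (row, column) ↦ symbol.
-- The set of triples is {(r, c, L r c)}; the Latin property (distinct
-- triples agree in at most one coordinate) is injectivity of every row and
-- every column.

Square : ℕ → Set
Square n = Fin n → Fin n → Fin n

IsLatin : ∀ {n} → Square n → Set
IsLatin {n} L =
  (∀ r c₁ c₂ → L r c₁ ≡ L r c₂ → c₁ ≡ c₂) ×
  (∀ c r₁ r₂ → L r₁ c ≡ L r₂ c → r₁ ≡ r₂)

IsSymmetric : ∀ {n} → Square n → Set
IsSymmetric L = ∀ r c → L r c ≡ L c r

-- The rrs-isotopism (α, α, γ) maps L to M:  (r,c,s) ∈ L ⇒ (rα, cα, sγ) ∈ M.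
MapsTo : ∀ {n} → (Fin n → Fin n) → (Fin n → Fin n) → Square n → Square n → Set
MapsTo α γ L M = ∀ r c → M (α r) (α c) ≡ γ (L r c)

RRSIsotopic : ∀ {n} → Square n → Square n → Set
RRSIsotopic {n} L M =
  Σ (Permutation′ n) λ α → Σ (Permutation′ n) λ γ →
    MapsTo (α ⟨$⟩ʳ_) (γ ⟨$⟩ʳ_) L M

Isomorphic : ∀ {n} → Square n → Square n → Set
Isomorphic {n} L M =
  Σ (Permutation′ n) λ σ → MapsTo (σ ⟨$⟩ʳ_) (σ ⟨$⟩ʳ_) L M

allVecs : ∀ {A : Set} → List A → (k : ℕ) → List (Vec A k)
allVecs xs zero    = [ [] ]
allVecs xs (suc k) = concatMap (λ x → map (x ∷_) (allVecs xs k)) xs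

IsPermVec : ∀ {n} → Vec (Fin n) n → Set
IsPermVec v = ∀ i j → lookup v i ≡ lookup v j → i ≡ j

isPermVec? : ∀ {n} (v : Vec (Fin n) n) → Dec (IsPermVec v)
isPermVec? v = all? λ i → all? λ j → (lookup v i ≟ lookup v j) →-dec (i ≟ j)

allPerms : (n : ℕ) → List (Vec (Fin n) n)
allPerms n = filter isPermVec? (allVecs (allFin n) n)

IsAutotopism : ∀ {n} → Square n → Vec (Fin n) n → Vec (Fin n) n → Set
IsAutotopism L a b = MapsTo (lookup a) (lookup b) L L

isAutotopism? : ∀ {n} (L : Square n) a b → Dec (IsAutotopism L a b)
isAutotopism? L a b = all? λ r → all? λ c → L (lookup a r) (lookup a c) ≟ lookup b (L r c)

-- The rrs-autotopism group Γ of L, listed as the pairs (α, β) with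
-- (α, α, β) an autotopism (each element exactly once).
rrsAutotopisms : ∀ {n} → Square n → List (Vec (Fin n) n × Vec (Fin n) n)
rrsAutotopisms {n} L =
  filter (λ p → isAutotopism? L (proj₁ p) (proj₂ p))
         (cartesianProduct (allPerms n) (allPerms n))

iter : ∀ {n} → (Fin n → Fin n) → ℕ → Fin n → Fin n
iter f zero    x = x
iter f (suc k) x = f (iter f k x)

cycLen : ∀ {n} → (Fin n → Fin n) → Fin n → ℕ
cycLen {n} f x = go 1 n
  where
  go : ℕ → ℕ → ℕ
  go k zero       = 0
  go k (suc fuel) = if ⌊ iter f k x ≟ x ⌋ then k else go (suc k) fuel

numCycles : ∀ {n} → (Fin n → Fin n) → ℕ → ℕ
numCycles {n} f i =
  length (filter (λ x → cycLen f x ℕP.≟ suc i) (allFin n)) / suc i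

sameCycleStructure? : ∀ {n} → (Fin n → Fin n) → (Fin n → Fin n) → Bool
sameCycleStructure? {n} f g = go (upTo n)
  where
  go : List ℕ → Bool
  go []       = true
  go (i ∷ is) = if ⌊ numCycles f i ℕP.≟ numCycles g i ⌋ then go is else false

-- ψ(α, β) = ∏ (n_i)! c_i^{n_i} if α, β have the same cycle structure, else 0.
-- (Cycle lengths c with no cycles contribute the factor 0! c^0 = 1.)
ψ : ∀ {n} → Vec (Fin n) n → Vec (Fin n) n → ℕ
ψ {n} a b =
  if sameCycleStructure? (lookup a) (lookup b)
  then product (map (λ i → (numCycles (lookup a) i) ! * (suc i) ^ numCycles (lookup a) i) (upTo n))
  else 0

IsClassReps : ∀ {n} → Square n → List (Square n) → Set
IsClassReps {n} L reps =
  All (λ M → IsLatin M × IsSymmetric M × RRSIsotopic L M) reps ×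
  AllPairs (λ M M' → ¬ Isomorphic M M') reps ×
  (∀ (M : Square n) → IsLatin M → IsSymmetric M → RRSIsotopic L M →
     Any (λ M' → Isomorphic M M') reps)

{-# OPTIONS --safe #-}
module Submission where

-- Up to isomorphism every square rrs-isotopic to L is γ ∘ L for a permutation
-- γ of the symbols, and γ ∘ L ≅ γ′ ∘ L exactly when γ′ = α γ β⁻¹ for some
-- (α, α, β) ∈ Γ.  The classes are thus the orbits of Γ acting on permutations
-- by γ ↦ α γ β⁻¹, and Burnside's lemma applies.  The fixed points of (α, β)
-- are the γ with α γ = γ β.  Such a γ is determined by its values on
-- representatives of the cycles of β: a representative of a cycle of length c
-- may go to any point of any cycle of α of length c that is not yet taken.  If
-- k cycles of length c remain, this leaves k c choices, whence ψ(α, β).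

open import Defs
open import Data.Bool using (Bool; true; false; if_then_else_)
open import Data.Empty using (⊥; ⊥-elim)
open import Data.Fin using (Fin; toℕ; fromℕ<)
open import Data.Fin.Permutation using (Permutation′; _⟨$⟩ʳ_; _⟨$⟩ˡ_; permutation; inverseˡ; inverseʳ; flip; _∘ₚ_)
import Data.Fin.Permutation as Permutation
open import Data.Fin.Properties using (_≟_; any?; all?; pigeonhole; toℕ<n; toℕ-fromℕ<)
open import Data.List using (List; []; _∷_; map; length; filter; upTo; allFin; cartesianProduct)
open import Data.List.Membership.Propositional using (_∈_; find; lose)
open import Data.List.Membership.Propositional.Properties using (∈-allFin; ∈-cartesianProduct⁺; ∈-cartesianProduct⁻; ∈-concatMap⁺; ∈-filter⁺; ∈-filter⁻; ∈-map⁺; ∈-map⁻; ∈-upTo⁺; ∈-upTo⁻)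
open import Data.List.Properties using (length-map; length-upTo; map-∘; map-cong-local)
open import Data.List.Relation.Unary.All using (All; []; _∷_)
import Data.List.Relation.Unary.All as All
import Data.List.Relation.Unary.All.Properties as AllP
open import Data.List.Relation.Unary.AllPairs using (AllPairs; []; _∷_)
import Data.List.Relation.Unary.AllPairs as AllPairs
import Data.List.Relation.Unary.AllPairs.Properties as AllPairsP
open import Data.List.Relation.Unary.Any using (Any; here; there)
import Data.List.Relation.Unary.Any as Any
import Data.List.Relation.Unary.Any.Properties as AnyP
open import Data.List.Relation.Unary.Unique.Propositional using (Unique)
import Data.List.Relation.Unary.Unique.Propositional.Properties as Unique
open import Data.Nat using (ℕ; zero; suc; pred; _+_; _*_; _∸_; _^_; _!; _/_; _%_; _≤_; _<_; z≤n; s≤s; NonZero; >-nonZero)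
open import Data.Nat.DivMod using (m≡m%n+[m/n]*n; m%n<n; m*n/n≡m)
open import Data.Nat.ListAction using (sum; product)
import Data.Nat.Properties as ℕP
open import Data.Nat.Tactic.RingSolver using (solve-∀)
open import Data.Product using (Σ; ∃; _×_; _,_; proj₁; proj₂)
import Data.Product.Properties as ProductP
open import Data.Sum using (_⊎_; inj₁; inj₂; [_,_]′)
open import Data.Vec using (Vec; []; _∷_; lookup; tabulate)
import Data.Vec.Properties as VecP
open import Relation.Binary.Definitions using (DecidableEquality; tri<; tri≈; tri>)
open import Relation.Binary.PropositionalEquality using (_≡_; _≢_; refl; sym; trans; cong; cong₂; subst; module ≡-Reasoning)
open import Relation.Nullary using (¬_; ¬?; Dec; yes; no; _×-dec_)
open import Relation.Nullary.Decidable using (⌊_⌋; map′)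
open import Relation.Unary using (Decidable)

-- Sums and counting over lists

-- Every cardinality is a sum of indicators `𝟙` over an explicit list, so that a bijection, a
-- partition into cycles and the orbit-stabilizer count all become exchanges of two sums. The figure
-- of `k c` choices rests on an invariant. For each length `c`, the points on cycles of α of length
-- `c` number `c` times the cycles of β of that length, pending and assigned ones together. Assigned
-- cycles of β and taken cycles of α agree in length, so the taken points cancel. Equality of the
-- cycle structures is this invariant before any assignment. Conversely a single γ with α γ = γ β
-- carries cycles to cycles of the same length and forces the structures to agree, which is why ψ
-- may vanish otherwise. The link between isomorphisms and Γ comes from solving for `L`: if σ maps
-- `v ∘ L` to `w ∘ L`, then `L (σ r) (σ c)` is the image of `L r c` under `w⁻¹ σ v`. The symbol part
-- of the autotopism is thus forced, and it is exactly the β with `w = σ v β⁻¹`.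

private variable
  A B : Set

∑ : List A → (A → ℕ) → ℕ
∑ xs h = sum (map h xs)

𝟙 : {P : Set} → Dec P → ℕ
𝟙 d = if ⌊ d ⌋ then 1 else 0

count : {P : A → Set} → Decidable P → List A → ℕ
count P? xs = ∑ xs (λ x → 𝟙 (P? x))

𝟙-yes : {P : Set} (d : Dec P) → P → 𝟙 d ≡ 1
𝟙-yes (yes _) _ = refl
𝟙-yes (no ¬p) p = ⊥-elim (¬p p)

𝟙-no : {P : Set} (d : Dec P) → ¬ P → 𝟙 d ≡ 0
𝟙-no (yes p) ¬p = ⊥-elim (¬p p)
𝟙-no (no _)  _  = refl

𝟙-cong : {P Q : Set} (d : Dec P) (e : Dec Q) → (P → Q) → (Q → P) → 𝟙 d ≡ 𝟙 e
𝟙-cong (yes p) e to from = sym (𝟙-yes e (to p))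
𝟙-cong (no ¬p) e to from = sym (𝟙-no e (λ q → ¬p (from q)))

∑-cong-∈ : ∀ {h k : A → ℕ} xs → (∀ {x} → x ∈ xs → h x ≡ k x) → ∑ xs h ≡ ∑ xs k
∑-cong-∈ []       _  = refl
∑-cong-∈ (x ∷ xs) eq = cong₂ _+_ (eq (here refl)) (∑-cong-∈ xs (λ x∈ → eq (there x∈)))

∑-cong : ∀ {h k : A → ℕ} xs → (∀ x → h x ≡ k x) → ∑ xs h ≡ ∑ xs k
∑-cong xs eq = ∑-cong-∈ xs (λ {x} _ → eq x)

∑-const : ∀ c (xs : List A) → ∑ xs (λ _ → c) ≡ length xs * c
∑-const c []       = refl
∑-const c (x ∷ xs) = cong (c +_) (∑-const c xs)

∑-zero : ∀ {h : A → ℕ} xs → (∀ {x} → x ∈ xs → h x ≡ 0) → ∑ xs h ≡ 0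
∑-zero []       _  = refl
∑-zero (x ∷ xs) eq = cong₂ _+_ (eq (here refl)) (∑-zero xs (λ x∈ → eq (there x∈)))

∑-+ : ∀ (h k : A → ℕ) xs → ∑ xs (λ x → h x + k x) ≡ ∑ xs h + ∑ xs k
∑-+ h k []       = refl
∑-+ h k (x ∷ xs) = trans (cong ((h x + k x) +_) (∑-+ h k xs)) (regroup (h x) (k x) _ _)
  where
  regroup : ∀ a b c d → a + b + (c + d) ≡ a + c + (b + d)
  regroup = solve-∀

∑-* : ∀ (h : A → ℕ) c xs → ∑ xs (λ x → h x * c) ≡ ∑ xs h * c
∑-* h c []       = refl
∑-* h c (x ∷ xs) = trans (cong (h x * c +_) (∑-* h c xs)) (sym (ℕP.*-distribʳ-+ c (h x) _))

∑-swap : ∀ (h : A → B → ℕ) xs ys →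
         ∑ xs (λ x → ∑ ys (h x)) ≡ ∑ ys (λ y → ∑ xs (λ x → h x y))
∑-swap h []       ys = sym (∑-zero ys (λ _ → refl))
∑-swap h (x ∷ xs) ys =
  trans (cong (∑ ys (h x) +_) (∑-swap h xs ys)) (sym (∑-+ (h x) _ ys))

length-filter : ∀ {P : A → Set} (P? : Decidable P) xs → length (filter P? xs) ≡ count P? xs
length-filter P? []       = refl
length-filter P? (x ∷ xs) with P? x
... | yes _ = cong suc (length-filter P? xs)
... | no  _ = length-filter P? xs

count-cong : ∀ {P Q : A → Set} (P? : Decidable P) (Q? : Decidable Q) xs →
             (∀ {x} → P x → Q x) → (∀ {x} → Q x → P x) → count P? xs ≡ count Q? xs
count-cong P? Q? xs to from = ∑-cong xs (λ x → 𝟙-cong (P? x) (Q? x) to from)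

count-none : ∀ {P : A → Set} (P? : Decidable P) xs → (∀ {x} → x ∈ xs → ¬ P x) → count P? xs ≡ 0
count-none P? xs none = ∑-zero xs (λ {x} x∈ → 𝟙-no (P? x) (none x∈))

-- Replaces the indicator of a disjoint union by the sum of the indicators of its members. In this
-- form cycles and orbits enter the exchanges of sums.
count-exclusive : ∀ {P : A → Set} (P? : Decidable P) {xs} →
                  AllPairs (λ x y → P x → ¬ P y) xs → Any P xs → count P? xs ≡ 1
count-exclusive P? {x ∷ xs} (ex ∷ _) (here px) = cong₂ _+_ (𝟙-yes (P? x) px)
  (count-none P? xs (λ y∈ → All.lookup ex y∈ px))
count-exclusive {P = P} P? {x ∷ xs} (ex ∷ exs) (there any) = cong₂ _+_
  (𝟙-no (P? x) (λ px → exclude px ex any)) (count-exclusive P? exs any)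
  where
  exclude : ∀ {ys} → P x → All (λ y → P x → ¬ P y) ys → ¬ Any P ys
  exclude px (¬py ∷ _) (here py)   = ¬py px py
  exclude px (_ ∷ ¬ps) (there any) = exclude px ¬ps any

count-unique : ∀ {P : A → Set} (P? : Decidable P) {xs x} → Unique xs → x ∈ xs → P x →
               (∀ {y} → P y → y ≡ x) → count P? xs ≡ 1
count-unique {P = P} P? u x∈ px only = count-exclusive P?
  (AllPairs.map (λ y≢z py pz → y≢z (trans (only py) (sym (only pz)))) u)
  (Any.map (λ x≡y → subst P x≡y px) x∈)

-- Both lengths count the related pairs, once row by row and once column by column.
length-bijection : ∀ {R : A → B → Set} (R? : ∀ x y → Dec (R x y)) xs ys →
                   (∀ {x} → x ∈ xs → count (R? x) ys ≡ 1) →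
                   (∀ {y} → y ∈ ys → count (λ x → R? x y) xs ≡ 1) →
                   length xs ≡ length ys
length-bijection R? xs ys right left = begin
  length xs                                 ≡⟨ ones xs ⟨
  ∑ xs (λ _ → 1)                            ≡⟨ ∑-cong-∈ xs right ⟨
  ∑ xs (λ x → ∑ ys (λ y → 𝟙 (R? x y)))      ≡⟨ ∑-swap _ xs ys ⟩
  ∑ ys (λ y → ∑ xs (λ x → 𝟙 (R? x y)))      ≡⟨ ∑-cong-∈ ys left ⟩
  ∑ ys (λ _ → 1)                            ≡⟨ ones ys ⟩
  length ys                                 ∎
  where
  open ≡-Reasoning
  ones : (zs : List A) → ∑ zs (λ _ → 1) ≡ length zs
  ones []       = refl
  ones (z ∷ zs) = cong suc (ones zs)

∑-map : ∀ (k : A → B) (h : B → ℕ) xs → ∑ (map k xs) h ≡ ∑ xs (λ x → h (k x))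
∑-map k h xs = cong sum (sym (map-∘ xs))

-- `AllPairs` compares an earlier entry with a later one, so symmetry of `S` settles the case in
-- which `y` precedes `x`.
separated-≡ : ∀ {S : A → A → Set} {xs x y} → (∀ {x y} → S x y → S y x) →
              AllPairs (λ x y → ¬ S x y) xs → x ∈ xs → y ∈ xs → S x y → x ≡ y
separated-≡ S-sym (_ ∷ _)    (here refl) (here refl) _ = refl
separated-≡ S-sym (¬s ∷ _)   (here refl) (there y∈)  s = ⊥-elim (All.lookup ¬s y∈ s)
separated-≡ S-sym (¬s ∷ _)   (there x∈)  (here refl) s = ⊥-elim (All.lookup ¬s x∈ (S-sym s))
separated-≡ S-sym (_ ∷ sep)  (there x∈)  (there y∈)  s = separated-≡ S-sym sep x∈ y∈ s

-- Representatives of the classes of a decidable relation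

module Representatives {A : Set} {R : A → A → Set} (R? : ∀ x y → Dec (R x y)) where

  reps : List A → List A
  reps []       = []
  reps (x ∷ xs) with Any.any? (R? x) (reps xs)
  ... | yes _ = reps xs
  ... | no  _ = x ∷ reps xs

  reps-⊆ : ∀ {xs y} → y ∈ reps xs → y ∈ xs
  reps-⊆ {x ∷ xs} y∈ with Any.any? (R? x) (reps xs)
  reps-⊆ {x ∷ xs} y∈         | yes _ = there (reps-⊆ y∈)
  reps-⊆ {x ∷ xs} (here eq)  | no  _ = here eq
  reps-⊆ {x ∷ xs} (there y∈) | no  _ = there (reps-⊆ y∈)

  reps-separated : ∀ xs → AllPairs (λ x y → ¬ R x y) (reps xs)
  reps-separated []       = []
  reps-separated (x ∷ xs) with Any.any? (R? x) (reps xs)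
  ... | yes _   = reps-separated xs
  ... | no none = AllP.¬Any⇒All¬ _ none ∷ reps-separated xs

  -- An element is dropped exactly when the test has found a representative related to it; a kept
  -- element represents itself.
  reps-cover : (∀ x → R x x) → ∀ {xs x} → x ∈ xs → Any (R x) (reps xs)
  reps-cover R-refl {x ∷ xs} x∈ with Any.any? (R? x) (reps xs)
  reps-cover R-refl {x ∷ xs} (here refl) | yes some = some
  reps-cover R-refl {x ∷ xs} (there x∈)  | yes some = reps-cover R-refl x∈
  reps-cover R-refl {x ∷ xs} (here refl) | no _     = here (R-refl x)
  reps-cover R-refl {x ∷ xs} (there x∈)  | no _     = there (reps-cover R-refl x∈)

-- Cycles of a permutation of Fin n

-- A named copy of the loop inside `cycLen`. The value 0 signals exhausted fuel; `returns` shows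
-- that `n` steps always suffice.
search : ∀ {n} → (Fin n → Fin n) → Fin n → ℕ → ℕ → ℕ
search f x k zero    = 0
search f x k (suc m) = if ⌊ iter f k x ≟ x ⌋ then k else search f x (suc k) m

-- The two equations characterise the loop, so it can be exchanged for `search` without being named.
search-unique : ∀ {n} (f : Fin n → Fin n) x (h : ℕ → ℕ → ℕ) → (∀ k → h k 0 ≡ 0) →
  (∀ k m → h k (suc m) ≡ (if ⌊ iter f k x ≟ x ⌋ then k else h (suc k) m)) →
  ∀ k m → h k m ≡ search f x k m
search-unique f x h h0 hs k zero = h0 k
search-unique f x h h0 hs k (suc m) rewrite hs k m | search-unique f x h h0 hs (suc k) m = refl

mutual
  -- The local function in the definition of cycLen has no name outside its
  -- clause; unification in cycLen≡search recovers it as the value of this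
  -- placeholder, once the fuel has been separated from the order n.
  cycLen-loop : ∀ {n} → (Fin n → Fin n) → Fin n → ℕ → ℕ → ℕ
  cycLen-loop f x = _

  cycLen≡search : ∀ {n} (f : Fin n → Fin n) x → cycLen f x ≡ search f x 1 n
  -- The test at exponent 1 is already unfolded, so the loop stands at 2 with fuel `m`.
  cycLen≡search {suc m} f x with suc m | f | x | 2
  ... | n | f′ | x′ | k with ⌊ f′ x′ ≟ x′ ⌋
  ... | true  = refl
  ... | false = search-unique f′ x′ (cycLen-loop f′ x′) (λ _ → refl) (λ _ _ → refl) k m

search-spec : ∀ {n} (f : Fin n → Fin n) x k m {j} → k ≤ j → j < k + m → iter f j x ≡ x →
  let s = search f x k m in
  k ≤ s × s < k + m × iter f s x ≡ x × (∀ {i} → k ≤ i → i < s → iter f i x ≢ x)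
search-spec f x k zero k≤j j<k+0 _ =
  ⊥-elim (ℕP.<⇒≱ (subst (_ <_) (ℕP.+-identityʳ k) j<k+0) k≤j)
search-spec f x k (suc m) {j} k≤j j<k+m fʲx≡x with iter f k x ≟ x
... | yes fᵏx≡x = ℕP.≤-refl , ℕP.m<m+n k (s≤s z≤n) , fᵏx≡x , λ k≤i i<k → ⊥-elim (ℕP.<⇒≱ i<k k≤i)
... | no  fᵏx≢x with search-spec f x (suc k) m
                       (ℕP.≤∧≢⇒< k≤j (λ { refl → fᵏx≢x fʲx≡x }))
                       (subst (j <_) (ℕP.+-suc k m) j<k+m) fʲx≡x
... | k<s , s<k+m , fˢx≡x , minimal =
  ℕP.<⇒≤ k<s , subst (search f x (suc k) m <_) (sym (ℕP.+-suc k m)) s<k+m , fˢx≡x , below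
  where
  below : ∀ {i} → k ≤ i → i < search f x (suc k) m → iter f i x ≢ x
  below {i} k≤i i<s with k ℕP.≟ i
  ... | yes refl = fᵏx≢x
  ... | no  k≢i  = minimal (ℕP.≤∧≢⇒< k≤i k≢i) i<s

module Orbits {n} (f : Fin n → Fin n) (f-injective : ∀ {x y} → f x ≡ f y → x ≡ y) where

  iter-+ : ∀ i j x → iter f (i + j) x ≡ iter f i (iter f j x)
  iter-+ zero    j x = refl
  iter-+ (suc i) j x = cong f (iter-+ i j x)

  iter-comm : ∀ i j x → iter f i (iter f j x) ≡ iter f j (iter f i x)
  iter-comm i j x = trans (sym (iter-+ i j x))
    (trans (cong (λ k → iter f k x) (ℕP.+-comm i j)) (iter-+ j i x))

  iter-injective : ∀ k {x y} → iter f k x ≡ iter f k y → x ≡ y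
  iter-injective zero    eq = eq
  iter-injective (suc k) eq = iter-injective k (f-injective eq)

  iter-cancel : ∀ {i j} x → i ≤ j → iter f i x ≡ iter f j x → iter f (j ∸ i) x ≡ x
  iter-cancel {i} {j} x i≤j eq = sym (iter-injective i (begin
    iter f i x                     ≡⟨ eq ⟩
    iter f j x                     ≡⟨ cong (λ k → iter f k x) (ℕP.m+[n∸m]≡n i≤j) ⟨
    iter f (i + (j ∸ i)) x         ≡⟨ iter-+ i (j ∸ i) x ⟩
    iter f i (iter f (j ∸ i) x)    ∎))
    where open ≡-Reasoning

  iter-multiple : ∀ {c x} k → iter f c x ≡ x → iter f (k * c) x ≡ x
  iter-multiple         zero    eq = refl
  iter-multiple {c} {x} (suc k) eq =
    trans (iter-+ c (k * c) x) (trans (cong (iter f c) (iter-multiple k eq)) eq)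

  -- Two of the `n + 1` points with exponents 0 to `n` coincide, and injectivity cancels the smaller
  -- exponent. The difference is between 1 and `n`, which is the window that `cycLen` searches.
  returns : ∀ x → ∃ λ k → 1 ≤ k × k < 1 + n × iter f k x ≡ x
  returns x with pigeonhole (ℕP.n<1+n n) (λ i → iter f (toℕ i) x)
  ... | i , j , i<j , eq =
    toℕ j ∸ toℕ i , ℕP.m<n⇒0<n∸m i<j ,
    ℕP.≤-<-trans (ℕP.m∸n≤m (toℕ j) (toℕ i)) (toℕ<n j) , iter-cancel x (ℕP.<⇒≤ i<j) eq

  period : ∀ x → let c = cycLen f x in
    1 ≤ c × c < 1 + n × iter f c x ≡ x × (∀ {i} → 1 ≤ i → i < c → iter f i x ≢ x)
  period x rewrite cycLen≡search f x with returns x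
  ... | k , 1≤k , k≤n , eq = search-spec f x 1 n 1≤k k≤n eq

  cycLen>0 : ∀ x → 0 < cycLen f x
  cycLen>0 x = proj₁ (period x)

  cycLen≤n : ∀ x → cycLen f x ≤ n
  cycLen≤n x = ℕP.≤-pred (proj₁ (proj₂ (period x)))

  iter-cycLen : ∀ x → iter f (cycLen f x) x ≡ x
  iter-cycLen x = proj₁ (proj₂ (proj₂ (period x)))

  cycLen-minimal : ∀ x {i} → 1 ≤ i → i < cycLen f x → iter f i x ≢ x
  cycLen-minimal x = proj₂ (proj₂ (proj₂ (period x)))

  cycLen-unique : ∀ {c x} → 1 ≤ c → iter f c x ≡ x → (∀ {i} → 1 ≤ i → i < c → iter f i x ≢ x) →
                  cycLen f x ≡ c
  cycLen-unique {c} {x} 1≤c eq minimal with ℕP.<-cmp (cycLen f x) c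
  ... | tri< lt _ _ = ⊥-elim (minimal (cycLen>0 x) lt (iter-cycLen x))
  ... | tri≈ _ ≡c _ = ≡c
  ... | tri> _ _ gt = ⊥-elim (cycLen-minimal x 1≤c gt eq)

  module _ (x : Fin n) where

    private instance
      cycLen-nonZero : NonZero (cycLen f x)
      cycLen-nonZero = >-nonZero (cycLen>0 x)

    iter-% : ∀ k → iter f (k % cycLen f x) x ≡ iter f k x
    iter-% k = begin
      iter f (k % c) x                        ≡⟨ cong (iter f (k % c)) (iter-multiple (k / c) (iter-cycLen x)) ⟨
      iter f (k % c) (iter f (k / c * c) x)   ≡⟨ iter-+ (k % c) (k / c * c) x ⟨
      iter f (k % c + k / c * c) x            ≡⟨ cong (λ j → iter f j x) (m≡m%n+[m/n]*n k c) ⟨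
      iter f k x                              ∎
      where
      open ≡-Reasoning
      c = cycLen f x

    reduce : ∀ k → ∃ λ i → i < cycLen f x × iter f i x ≡ iter f k x
    reduce k = k % cycLen f x , m%n<n k (cycLen f x) , iter-% k

    -- A nonzero remainder modulo the cycle length would be an earlier return.
    cycLen-divides : ∀ k → iter f k x ≡ x → ∃ λ q → k ≡ q * cycLen f x
    cycLen-divides k eq
      with k % cycLen f x | m%n<n k (cycLen f x) | iter-% k | m≡m%n+[m/n]*n k (cycLen f x)
    ... | zero  | _   | _   | k≡ = k / cycLen f x , k≡
    ... | suc i | i<c | eq′ | _  = ⊥-elim (cycLen-minimal x (s≤s z≤n) i<c (trans eq′ eq))

  iter-injective-< : ∀ x {i j} → i < cycLen f x → j < cycLen f x → iter f i x ≡ iter f j x → i ≡ j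
  iter-injective-< x {i} {j} i<c j<c eq with ℕP.<-cmp i j
  ... | tri≈ _ i≡j _ = i≡j
  ... | tri< i<j _ _ = ⊥-elim (cycLen-minimal x (ℕP.m<n⇒0<n∸m i<j)
          (ℕP.≤-<-trans (ℕP.m∸n≤m j i) j<c) (iter-cancel x (ℕP.<⇒≤ i<j) eq))
  ... | tri> _ _ j<i = ⊥-elim (cycLen-minimal x (ℕP.m<n⇒0<n∸m j<i)
          (ℕP.≤-<-trans (ℕP.m∸n≤m i j) i<c) (iter-cancel x (ℕP.<⇒≤ j<i) (sym eq)))

  -- The inverse as a power of `f`: the point one step before the cycle of `y` closes.
  f⁻¹ : Fin n → Fin n
  f⁻¹ y = iter f (pred (cycLen f y)) y

  f∘f⁻¹ : ∀ y → f (f⁻¹ y) ≡ y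
  f∘f⁻¹ y = trans
    (cong (λ k → iter f k y) (ℕP.suc-pred (cycLen f y) {{>-nonZero (cycLen>0 y)}}))
    (iter-cycLen y)

  -- The exponent ranges over `Fin n` to make the relation decidable. Nothing is lost, since
  -- exponents reduce modulo a cycle length of at most `n`.
  Orbit : Fin n → Fin n → Set
  Orbit x y = ∃ λ (k : Fin n) → iter f (toℕ k) x ≡ y

  orbit? : ∀ x y → Dec (Orbit x y)
  orbit? x y = any? (λ k → iter f (toℕ k) x ≟ y)

  orbit-iter : ∀ k x → Orbit x (iter f k x)
  orbit-iter k x with reduce x k
  ... | i , i<c , eq = fromℕ< i<n , trans (cong (λ j → iter f j x) (toℕ-fromℕ< i<n)) eq
    where i<n = ℕP.<-≤-trans i<c (cycLen≤n x)

  orbit-refl : ∀ x → Orbit x x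
  orbit-refl = orbit-iter 0

  orbit-trans : ∀ {x y z} → Orbit x y → Orbit y z → Orbit x z
  orbit-trans {x} (k , refl) (j , refl) =
    subst (Orbit x) (iter-+ (toℕ j) (toℕ k) x) (orbit-iter (toℕ j + toℕ k) x)

  orbit-sym : ∀ {x y} → Orbit x y → Orbit y x
  -- Since `c` is at least 1, `k * c` is at least `k`; going `k` times round the cycle undoes the
  -- `k` steps already made.
  orbit-sym {x} (i , refl) = subst (Orbit (iter f k x)) back (orbit-iter (k * c ∸ k) (iter f k x))
    where
    k = toℕ i
    c = cycLen f x
    back : iter f (k * c ∸ k) (iter f k x) ≡ x
    back = trans (sym (iter-+ (k * c ∸ k) k x))
      (trans (cong (λ j → iter f j x) (ℕP.m∸n+n≡m (ℕP.m≤m*n k c {{>-nonZero (cycLen>0 x)}})))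
             (iter-multiple k (iter-cycLen x)))

  cycLen-iter : ∀ k x → cycLen f (iter f k x) ≡ cycLen f x
  cycLen-iter k x = cycLen-unique (cycLen>0 x)
    (trans (iter-comm (cycLen f x) k x) (cong (iter f k) (iter-cycLen x)))
    (λ {i} 1≤i i<c eq → cycLen-minimal x 1≤i i<c (iter-injective k (trans (iter-comm k i x) eq)))

  cycLen-orbit : ∀ {x y} → Orbit x y → cycLen f y ≡ cycLen f x
  cycLen-orbit {x} (k , refl) = cycLen-iter (toℕ k) x

  -- The iterates with exponents below `c` are distinct and exhaust the orbit, so each point of the
  -- orbit is hit by exactly one exponent.
  orbit-size : ∀ x → count (orbit? x) (allFin n) ≡ cycLen f x
  orbit-size x = begin
    count (orbit? x) (allFin n)
      ≡⟨ ∑-cong (allFin n) hits ⟩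
    ∑ (allFin n) (λ y → count (λ i → iter f i x ≟ y) (upTo c))
      ≡⟨ ∑-swap _ (allFin n) (upTo c) ⟩
    ∑ (upTo c) (λ i → count (λ y → iter f i x ≟ y) (allFin n))
      ≡⟨ ∑-cong (upTo c) (λ i → count-unique (iter f i x ≟_) (Unique.allFin⁺ n) (∈-allFin _) refl sym) ⟩
    ∑ (upTo c) (λ _ → 1)
      ≡⟨ ∑-const 1 (upTo c) ⟩
    length (upTo c) * 1
      ≡⟨ trans (ℕP.*-identityʳ _) (length-upTo c) ⟩
    c ∎
    where
    open ≡-Reasoning
    c = cycLen f x

    exclusive : ∀ {y} → AllPairs (λ i j → iter f i x ≡ y → iter f j x ≢ y) (upTo c)
    exclusive = AllPairsP.applyUpTo⁺₁ _ c (λ i<j j<c fⁱ fʲ →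
      ℕP.<⇒≢ i<j (iter-injective-< x (ℕP.<-trans i<j j<c) j<c (trans fⁱ (sym fʲ))))

    hits : ∀ y → 𝟙 (orbit? x y) ≡ count (λ i → iter f i x ≟ y) (upTo c)
    hits y with orbit? x y
    ... | no  ¬o = sym (count-none _ (upTo c) (λ {i} _ eq → ¬o (subst (Orbit x) eq (orbit-iter i x))))
    ... | yes (k , eq) with reduce x (toℕ k)
    ... | i , i<c , eq′ = sym (count-exclusive _ exclusive (lose (∈-upTo⁺ i<c) (trans eq′ eq)))

  orbit-exclusive : ∀ {ys z} → AllPairs (λ x y → ¬ Orbit x y) ys →
                    AllPairs (λ x y → Orbit x z → ¬ Orbit y z) ys
  orbit-exclusive = AllPairs.map (λ ¬o ox oy → ¬o (orbit-trans ox (orbit-sym oy)))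

  -- The values still open to a representative of a cycle of length `c` when the cycles through `ys`
  -- are taken.
  free? : ∀ ys c (y : Fin n) → Dec (cycLen f y ≡ c × ¬ Any (λ z → Orbit z y) ys)
  free? ys c y = (cycLen f y ℕP.≟ c) ×-dec ¬? (Any.any? (λ z → orbit? z y) ys)

  -- A point on a cycle of length `c` is free or lies on the cycle of exactly one `z` in `ys`; such
  -- a cycle accounts for `c` points if it has length `c` and for none otherwise.
  count-free : ∀ ys c → AllPairs (λ x y → ¬ Orbit x y) ys →
    count (λ y → cycLen f y ℕP.≟ c) (allFin n)
      ≡ count (free? ys c) (allFin n) + count (λ y → cycLen f y ℕP.≟ c) ys * c
  count-free ys c separated = begin
    count (λ y → cycLen f y ℕP.≟ c) (allFin n)
      ≡⟨ ∑-cong (allFin n) split ⟩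
    ∑ (allFin n) (λ y → 𝟙 (free? ys c y) + ∑ ys (λ z → 𝟙 (hit? z y)))
      ≡⟨ ∑-+ _ _ (allFin n) ⟩
    count (free? ys c) (allFin n) + ∑ (allFin n) (λ y → ∑ ys (λ z → 𝟙 (hit? z y)))
      ≡⟨ cong (count (free? ys c) (allFin n) +_) (∑-swap _ (allFin n) ys) ⟩
    count (free? ys c) (allFin n) + ∑ ys (λ z → count (hit? z) (allFin n))
      ≡⟨ cong (count (free? ys c) (allFin n) +_) (trans (∑-cong ys hits) (∑-* _ c ys)) ⟩
    count (free? ys c) (allFin n) + count (λ y → cycLen f y ℕP.≟ c) ys * c ∎
    where
    open ≡-Reasoning
    hit? : ∀ z y → Dec (cycLen f y ≡ c × Orbit z y)
    hit? z y = (cycLen f y ℕP.≟ c) ×-dec orbit? z y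

    split : ∀ y → 𝟙 (cycLen f y ℕP.≟ c) ≡ 𝟙 (free? ys c y) + ∑ ys (λ z → 𝟙 (hit? z y))
    split y with cycLen f y ℕP.≟ c
    ... | no  _ = sym (∑-zero ys (λ _ → refl))
    ... | yes y≡c with Any.any? (λ z → orbit? z y) ys
    ... | yes some = sym (trans
      (∑-cong ys (λ z → 𝟙-cong _ (orbit? z y) proj₂ (λ o → y≡c , o)))
      (count-exclusive (λ z → orbit? z y) (orbit-exclusive separated) some))
    ... | no none = cong suc (sym (∑-zero ys (λ {z} z∈ → 𝟙-no _ (λ o → none (lose z∈ (proj₂ o))))))

    hits : ∀ z → count (hit? z) (allFin n) ≡ 𝟙 (cycLen f z ℕP.≟ c) * c
    hits z with cycLen f z ℕP.≟ c
    ... | yes refl = trans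
      (trans (count-cong (hit? z) (orbit? z) (allFin n) proj₂ (λ o → cycLen-orbit o , o)) (orbit-size z))
      (sym (ℕP.*-identityˡ c))
    ... | no  z≢c  = count-none (hit? z) (allFin n)
      (λ { _ (y≡c , o) → z≢c (trans (sym (cycLen-orbit o)) y≡c) })

  cycleReps : List (Fin n)
  cycleReps = Representatives.reps orbit? (allFin n)

  cycleReps-separated : AllPairs (λ x y → ¬ Orbit x y) cycleReps
  cycleReps-separated = Representatives.reps-separated orbit? (allFin n)

  cycleReps-cover : ∀ x → Any (λ r → Orbit r x) cycleReps
  cycleReps-cover x = Any.map orbit-sym (Representatives.reps-cover orbit? orbit-refl (∈-allFin x))

  -- When every cycle has a representative in the list, no point is free. The division in
  -- `numCycles` is therefore exact.
  count-cycLen : ∀ c → count (λ y → cycLen f y ℕP.≟ c) (allFin n)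
                       ≡ count (λ y → cycLen f y ℕP.≟ c) cycleReps * c
  count-cycLen c = trans (count-free cycleReps c cycleReps-separated)
    (cong (_+ count (λ y → cycLen f y ℕP.≟ c) cycleReps * c)
      (count-none (free? cycleReps c) (allFin n) (λ {y} _ free → proj₂ free (cycleReps-cover y))))

  numCycles-reps : ∀ i → numCycles f i ≡ count (λ y → cycLen f y ℕP.≟ suc i) cycleReps
  numCycles-reps i = trans (cong (_/ suc i) (trans (length-filter _ (allFin n)) (count-cycLen (suc i))))
    (m*n/n≡m _ (suc i))

-- Permutations commuting with a pair of permutations

∈-allVecs : ∀ {xs : List A} → (∀ x → x ∈ xs) → ∀ {k} (v : Vec A k) → v ∈ allVecs xs k
∈-allVecs all∈ []      = here refl
∈-allVecs {xs = xs} all∈ (x ∷ v) = ∈-concatMap⁺ (λ y → map (y ∷_) (allVecs xs _))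
  (Any.map (λ { refl → ∈-map⁺ (x ∷_) (∈-allVecs all∈ v) }) (all∈ x))

allVecs-unique : ∀ {xs : List A} → Unique xs → ∀ k → Unique (allVecs xs k)
allVecs-unique u zero    = [] ∷ []
allVecs-unique u (suc k) = Unique.concat⁺
  (AllP.map⁺ (All.tabulate (λ _ → Unique.map⁺ VecP.∷-injectiveʳ (allVecs-unique u k))))
  (AllPairsP.map⁺ (AllPairs.map (λ { x≢y {_} (∈x , ∈y) → disjoint x≢y (∈-map⁻ _ ∈x) (∈-map⁻ _ ∈y) }) u))
  where
  disjoint : ∀ {x y : A} {k} {v : Vec A (suc k)} {vs} → x ≢ y →
             (∃ λ a → a ∈ vs × v ≡ x ∷ a) → (∃ λ b → b ∈ vs × v ≡ y ∷ b) → ⊥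
  disjoint x≢y (_ , _ , v≡x∷a) (_ , _ , v≡y∷b) = x≢y (VecP.∷-injectiveˡ (trans (sym v≡x∷a) v≡y∷b))

∈-allPerms : ∀ {n} (v : Vec (Fin n) n) → IsPermVec v → v ∈ allPerms n
∈-allPerms v perm = ∈-filter⁺ isPermVec? (∈-allVecs ∈-allFin v) perm

allPerms-perm : ∀ {n} {v : Vec (Fin n) n} → v ∈ allPerms n → IsPermVec v
allPerms-perm {n} v∈ = proj₂ (∈-filter⁻ isPermVec? {xs = allVecs (allFin n) n} v∈)

allPerms-unique : ∀ n → Unique (allPerms n)
allPerms-unique n = Unique.filter⁺ isPermVec? (allVecs-unique (Unique.allFin⁺ n) n)

lookup-ext : ∀ {n} {v w : Vec A n} → (∀ i → lookup v i ≡ lookup w i) → v ≡ w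
lookup-ext {v = v} {w} eq =
  trans (sym (VecP.tabulate∘lookup v)) (trans (VecP.tabulate-cong eq) (VecP.tabulate∘lookup w))

-- Serves `weight-product`, where one more cycle changes the factor of a single length.
product-update : ∀ {h k : A → ℕ} t {j} {is} → Unique is → j ∈ is → h j ≡ t * k j →
                 (∀ {i} → i ≢ j → h i ≡ k i) → product (map h is) ≡ t * product (map k is)
product-update {k = k} t {is = i ∷ is} (i∉ ∷ _) (here refl) at off =
  trans (cong₂ _*_ at (cong product (map-cong-local (All.map (λ j≢i → off (λ i≡j → j≢i (sym i≡j))) i∉))))
        (ℕP.*-assoc t (k i) _)
product-update {k = k} t {is = i ∷ is} (i∉ ∷ u) (there j∈) at off =
  trans (cong₂ _*_ (off (All.lookup i∉ j∈)) (product-update t u j∈ at off))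
        (swap t (k i) _)
  where
  swap : ∀ t a b → a * (t * b) ≡ t * (a * b)
  swap = solve-∀

-- Exponents that agree at `x` differ by a multiple of its cycle length, which is also that of `y`.
-- Hence sending each `iter g i x` to `iter f i y` is well defined; with `f` and `g` exchanged, the
-- same fact gives injectivity.
iter-transport : ∀ {n} {f g : Fin n → Fin n} (f-injective : ∀ {x y} → f x ≡ f y → x ≡ y)
  (g-injective : ∀ {x y} → g x ≡ g y → x ≡ y) {x y} → cycLen g x ≡ cycLen f y →
  ∀ i j → iter g i x ≡ iter g j x → iter f i y ≡ iter f j y
iter-transport {f = f} {g} f-inj g-inj {x} {y} len i j eq =
  [ (λ i≤j → ordered i≤j eq) , (λ j≤i → sym (ordered j≤i (sym eq))) ]′ (ℕP.≤-total i j)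
  where
  module F = Orbits f f-inj
  module G = Orbits g g-inj
  ordered : ∀ {i j} → i ≤ j → iter g i x ≡ iter g j x → iter f i y ≡ iter f j y
  ordered {i} {j} i≤j eq with G.cycLen-divides x (j ∸ i) (G.iter-cancel x i≤j eq)
  ... | q , j∸i≡qc = sym (begin
    iter f j y                            ≡⟨ cong (λ k → iter f k y) (ℕP.m+[n∸m]≡n i≤j) ⟨
    iter f (i + (j ∸ i)) y                ≡⟨ F.iter-+ i (j ∸ i) y ⟩
    iter f i (iter f (j ∸ i) y)           ≡⟨ cong (λ k → iter f i (iter f k y)) (trans j∸i≡qc (cong (q *_) len)) ⟩
    iter f i (iter f (q * cycLen f y) y)  ≡⟨ cong (iter f i) (F.iter-multiple q (F.iter-cycLen y)) ⟩
    iter f i y                            ∎)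
    where open ≡-Reasoning

-- A named copy of the loop inside `sameCycleStructure?`.
agree : ∀ {n} → (Fin n → Fin n) → (Fin n → Fin n) → List ℕ → Bool
agree f g []       = true
agree f g (i ∷ is) = if ⌊ numCycles f i ℕP.≟ numCycles g i ⌋ then agree f g is else false

agree-loop-unique : ∀ {n} (f g : Fin n → Fin n) (h : List ℕ → Bool) → h [] ≡ true →
  (∀ i is → h (i ∷ is) ≡ (if ⌊ numCycles f i ℕP.≟ numCycles g i ⌋ then h is else false)) →
  ∀ is → h is ≡ agree f g is
agree-loop-unique f g h h0 hs [] = h0
agree-loop-unique f g h h0 hs (i ∷ is) rewrite hs i is | agree-loop-unique f g h h0 hs is = refl

mutual
  -- As for cycLen-loop, a placeholder for a local function of Defs.
  sameCycleStructure-loop : ∀ {n} → (Fin n → Fin n) → (Fin n → Fin n) → List ℕ → Bool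
  sameCycleStructure-loop f g = _

  sameCycleStructure≡agree : ∀ {n} (f g : Fin n → Fin n) → sameCycleStructure? f g ≡ agree f g (upTo n)
  sameCycleStructure≡agree {n} f g with upTo n
  ... | is = agree-loop-unique f g (sameCycleStructure-loop f g) refl (λ _ _ → refl) is

agree-sound : ∀ {n} (f g : Fin n → Fin n) {is} → agree f g is ≡ true →
              All (λ i → numCycles f i ≡ numCycles g i) is
agree-sound f g {[]}     _  = []
agree-sound f g {i ∷ is} eq with numCycles f i ℕP.≟ numCycles g i
... | yes same = same ∷ agree-sound f g eq
agree-sound f g {i ∷ is} () | no _

agree-complete : ∀ {n} (f g : Fin n → Fin n) → (∀ i → numCycles f i ≡ numCycles g i) →
                 ∀ is → agree f g is ≡ true
agree-complete f g same []       = refl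
agree-complete f g same (i ∷ is) with numCycles f i ℕP.≟ numCycles g i
... | yes _    = agree-complete f g same is
... | no  diff = ⊥-elim (diff (same i))

module Conjugators {n} (f g : Fin n → Fin n) (f-injective : ∀ {x y} → f x ≡ f y → x ≡ y)
                   (g-injective : ∀ {x y} → g x ≡ g y → x ≡ y) where

  module F = Orbits f f-injective
  module G = Orbits g g-injective

  Commutes : Vec (Fin n) n → Set
  Commutes w = ∀ i → f (lookup w i) ≡ lookup w (g i)

  commutes? : ∀ w → Dec (Commutes w)
  commutes? w = all? (λ i → f (lookup w i) ≟ lookup w (g i))

  commutes-iter : ∀ w → Commutes w → ∀ k x → iter f k (lookup w x) ≡ lookup w (iter g k x)
  commutes-iter w comm zero    x = refl
  commutes-iter w comm (suc k) x = trans (cong f (commutes-iter w comm k x)) (comm _)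

  commutes-cycLen : ∀ w → IsPermVec w → Commutes w → ∀ x → cycLen f (lookup w x) ≡ cycLen g x
  commutes-cycLen w perm comm x = F.cycLen-unique (G.cycLen>0 x)
    (trans (commutes-iter w comm (cycLen g x) x) (cong (lookup w) (G.iter-cycLen x)))
    (λ {i} 1≤i i<c eq → G.cycLen-minimal x 1≤i i<c (perm _ _ (trans (sym (commutes-iter w comm i x)) eq)))

  commutes-orbit : ∀ w → IsPermVec w → Commutes w → ∀ {x y} →
                   F.Orbit (lookup w x) (lookup w y) → G.Orbit x y
  commutes-orbit w perm comm {x} (k , eq) =
    k , perm _ _ (trans (sym (commutes-iter w comm (toℕ k) x)) eq)

  -- The permutation `w` itself matches the points on cycles of `g` of a given length with those on
  -- cycles of `f` of that length.
  commutes-numCycles : ∀ w → IsPermVec w → Commutes w → ∀ i → numCycles f i ≡ numCycles g i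
  commutes-numCycles w perm comm i = cong (_/ suc i)
    (sym (length-bijection (λ x y → lookup w x ≟ y) (filter g? (allFin n)) (filter f? (allFin n))
      (λ {x} x∈ → count-unique (lookup w x ≟_) (Unique.filter⁺ f? (Unique.allFin⁺ n))
        (∈-filter⁺ f? (∈-allFin _)
          (trans (commutes-cycLen w perm comm x) (proj₂ (∈-filter⁻ g? {xs = allFin n} x∈))))
        refl sym)
      (λ {y} y∈ → count-unique (λ x → lookup w x ≟ y) (Unique.filter⁺ g? (Unique.allFin⁺ n))
        (∈-filter⁺ g? (∈-allFin _) (trans (sym (commutes-cycLen w perm comm _))
          (trans (cong (cycLen f) (W.f∘f⁻¹ y)) (proj₂ (∈-filter⁻ f? {xs = allFin n} y∈)))))
        (W.f∘f⁻¹ y) (λ eq → perm _ _ (trans eq (sym (W.f∘f⁻¹ y)))))))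
    where
    -- Supplies the inverse of `w`, as a power of `w`, for the preimages above.
    module W = Orbits (lookup w) (perm _ _)
    f? = λ x → cycLen f x ℕP.≟ suc i
    g? = λ x → cycLen g x ℕP.≟ suc i

  -- Extending partial assignments on cycle representatives

  Assignment : Set
  Assignment = List (Fin n × Fin n)

  Extends : Assignment → Vec (Fin n) n → Set
  Extends ps w = Commutes w × All (λ p → lookup w (proj₁ p) ≡ proj₂ p) ps

  extends? : ∀ ps w → Dec (Extends ps w)
  extends? ps w = commutes? w ×-dec All.all? (λ p → lookup w (proj₁ p) ≟ proj₂ p) ps

  extensions : Assignment → ℕ
  extensions ps = count (extends? ps) (allPerms n)

  -- Distinct cycles of `g` make the prescribed map well defined; distinct cycles of `f` make it
  -- injective.
  Separated : Assignment → Set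
  Separated = AllPairs (λ p q → ¬ (G.Orbit (proj₁ p) (proj₁ q) ⊎ F.Orbit (proj₂ p) (proj₂ q)))

  LengthPreserving : Assignment → Set
  LengthPreserving = All (λ p → cycLen g (proj₁ p) ≡ cycLen f (proj₂ p))

  module _ {ps} (separated : Separated ps) (lengths : LengthPreserving ps)
           (cover : ∀ z → Any (λ p → G.Orbit (proj₁ p) z) ps) where

    private
      same : ∀ {p q} → p ∈ ps → q ∈ ps →
             G.Orbit (proj₁ p) (proj₁ q) ⊎ F.Orbit (proj₂ p) (proj₂ q) → p ≡ q
      same = separated-≡ (λ { (inj₁ o) → inj₁ (G.orbit-sym o) ; (inj₂ o) → inj₂ (F.orbit-sym o) }) separated

      image : Fin n → Fin n
      image z with find (cover z)
      ... | p , _ , k , _ = iter f (toℕ k) (proj₂ p)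

      -- `cover` may present the same point with another exponent `j`. Separation forces the same
      -- pair, and `iter-transport` reconciles the two exponents.
      image-iter : ∀ {p} → p ∈ ps → ∀ k → image (iter g k (proj₁ p)) ≡ iter f k (proj₂ p)
      image-iter {p} p∈ k with find (cover (iter g k (proj₁ p)))
      ... | q , q∈ , j , eq
        with refl ← same q∈ p∈ (inj₁ (G.orbit-trans (j , eq) (G.orbit-sym (G.orbit-iter k (proj₁ p)))))
        = iter-transport f-injective g-injective (All.lookup lengths p∈) (toℕ j) k eq

      witness : Vec (Fin n) n
      witness = tabulate image

      lookup-witness : ∀ {p} → p ∈ ps → ∀ k → lookup witness (iter g k (proj₁ p)) ≡ iter f k (proj₂ p)
      lookup-witness p∈ k = trans (VecP.lookup∘tabulate image _) (image-iter p∈ k)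

      witness-commutes : Commutes witness
      witness-commutes z with find (cover z)
      ... | p , p∈ , k , refl =
        trans (cong f (lookup-witness p∈ (toℕ k))) (sym (lookup-witness p∈ (suc (toℕ k))))

      witness-perm : IsPermVec witness
      witness-perm y z eq with find (cover y) | find (cover z)
      -- Equal images lie on one cycle of `f`, so the second half of `Separated` identifies the
      -- pairs; what remains is a comparison of exponents on one cycle.
      ... | p , p∈ , j , refl | q , q∈ , k , refl
        with eq′ ← trans (sym (lookup-witness p∈ (toℕ j))) (trans eq (lookup-witness q∈ (toℕ k)))
        with refl ← same p∈ q∈ (inj₂ (F.orbit-trans (j , eq′) (F.orbit-sym (F.orbit-iter (toℕ k) (proj₂ q)))))
        = iter-transport g-injective f-injective (sym (All.lookup lengths p∈)) (toℕ j) (toℕ k) eq′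

    -- A value `y` at a representative `x` forces the value `iter f k y` at `iter g k x`. With every
    -- cycle of `g` covered, this leaves one candidate, and the candidate is a permutation.
    extensions-total : extensions ps ≡ 1
    extensions-total = count-unique (extends? ps) (allPerms-unique n) (∈-allPerms witness witness-perm)
      (witness-commutes , All.tabulate (λ p∈ → lookup-witness p∈ 0))
      (λ {w} (comm , agrees) → lookup-ext (determined w comm agrees))
      where
      determined : ∀ w → Commutes w → All (λ p → lookup w (proj₁ p) ≡ proj₂ p) ps →
                   ∀ z → lookup w z ≡ lookup witness z
      determined w comm agrees z with find (cover z)
      ... | p , p∈ , k , refl = trans (sym (commutes-iter w comm (toℕ k) (proj₁ p)))
        (trans (cong (iter f (toℕ k)) (All.lookup agrees p∈)) (sym (lookup-witness p∈ (toℕ k))))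

  -- Each `w` takes exactly one value at `x`.
  extensions-split : ∀ x ps → extensions ps ≡ ∑ (allFin n) (λ y → extensions ((x , y) ∷ ps))
  extensions-split x ps = trans (∑-cong (allPerms n) split) (∑-swap _ (allPerms n) (allFin n))
    where
    split : ∀ w → 𝟙 (extends? ps w) ≡ count (λ y → extends? ((x , y) ∷ ps) w) (allFin n)
    split w with extends? ps w
    ... | yes (comm , agrees) = sym (count-unique (λ y → extends? ((x , y) ∷ ps) w) (Unique.allFin⁺ n)
            (∈-allFin (lookup w x)) (comm , refl ∷ agrees) (λ { (_ , eq ∷ _) → sym eq }))
    ... | no  ¬e = sym (count-none (λ y → extends? ((x , y) ∷ ps) w) (allFin n)
            (λ { _ (comm , _ ∷ agrees) → ¬e (comm , agrees) }))

  cycles : List (Fin n) → ℕ → ℕ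
  cycles xs c = count (λ x → cycLen g x ℕP.≟ c) xs

  weight : List (Fin n) → ℕ
  weight []       = 1
  weight (x ∷ xs) = suc (cycles xs (cycLen g x)) * cycLen g x * weight xs

  length-index : ∀ x → ∃ λ i → cycLen g x ≡ suc i × i < n
  length-index x with cycLen g x | G.cycLen>0 x | G.cycLen≤n x
  ... | suc i | _ | i<n = i , refl , i<n

  -- A commuting permutation keeps cycle lengths and cannot send two cycles of `g` into one cycle of
  -- `f`.
  extensions-none : ∀ x y ps → All (λ p → ¬ G.Orbit x (proj₁ p)) ps →
    ¬ (cycLen f y ≡ cycLen g x × ¬ Any (λ z → F.Orbit z y) (map proj₂ ps)) →
    extensions ((x , y) ∷ ps) ≡ 0
  extensions-none x y ps apart ¬free = count-none (extends? _) (allPerms n) impossible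
    where
    impossible : ∀ {w} → w ∈ allPerms n → ¬ Extends ((x , y) ∷ ps) w
    impossible {w} w∈ (comm , refl ∷ agrees) =
      ¬free (commutes-cycLen w perm comm x , λ any → hit (find (AnyP.map⁻ any)))
      where
      perm = allPerms-perm w∈
      hit : ¬ (∃ λ p → p ∈ ps × F.Orbit (proj₂ p) (lookup w x))
      hit (p , p∈ , o) = All.lookup apart p∈ (G.orbit-sym (commutes-orbit w perm comm
        (subst (λ z → F.Orbit z (lookup w x)) (sym (All.lookup agrees p∈)) o)))

  -- Induction on the pending representatives `xs`. The last hypothesis is the invariant of the
  -- count: moving `x` from `xs` to `ps` leaves the sum of pending and assigned cycles of each
  -- length unchanged.
  extensions-weight : ∀ xs ps → Separated ps → LengthPreserving ps →
    AllPairs (λ x y → ¬ G.Orbit x y) xs → All (λ x → All (λ p → ¬ G.Orbit x (proj₁ p)) ps) xs →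
    (∀ z → Any (λ x → G.Orbit x z) xs ⊎ Any (λ p → G.Orbit (proj₁ p) z) ps) →
    (∀ {i} → i < n → count (λ y → cycLen f y ℕP.≟ suc i) (allFin n)
                     ≡ (cycles xs (suc i) + count (λ p → cycLen g (proj₁ p) ℕP.≟ suc i) ps) * suc i) →
    extensions ps ≡ weight xs
  extensions-weight [] ps sep len _ _ cover _ =
    extensions-total sep len (λ z → [ (λ ()) , (λ any → any) ]′ (cover z))
  extensions-weight (x ∷ xs) ps sep len (x-apart ∷ xs-apart) (x-new ∷ xs-new) cover num = begin
    extensions ps
      ≡⟨ extensions-split x ps ⟩
    ∑ (allFin n) (λ y → extensions ((x , y) ∷ ps))
      ≡⟨ ∑-cong (allFin n) choose ⟩
    ∑ (allFin n) (λ y → 𝟙 (F.free? ys c y) * weight xs)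
      ≡⟨ ∑-* _ (weight xs) (allFin n) ⟩
    count (F.free? ys c) (allFin n) * weight xs
      ≡⟨ cong (_* weight xs) choices ⟩
    suc (cycles xs c) * c * weight xs ∎
    where
    open ≡-Reasoning
    ys = map proj₂ ps
    c = cycLen g x

    choose : ∀ y → extensions ((x , y) ∷ ps) ≡ 𝟙 (F.free? ys c y) * weight xs
    choose y with F.free? ys c y
    ... | no ¬free = extensions-none x y ps x-new ¬free
    ... | yes (≡c , free) = trans
      (extensions-weight xs ((x , y) ∷ ps)
        (All.tabulate apart ∷ sep) (sym ≡c ∷ len) xs-apart
        (All.zipWith (λ (¬o , new) → (λ o → ¬o (G.orbit-sym o)) ∷ new) (x-apart , xs-new))
        cover′ num′)
      (sym (ℕP.*-identityˡ (weight xs)))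
      where
      apart : ∀ {p} → p ∈ ps → ¬ (G.Orbit x (proj₁ p) ⊎ F.Orbit y (proj₂ p))
      apart p∈ (inj₁ o) = All.lookup x-new p∈ o
      apart p∈ (inj₂ o) = free (AnyP.map⁺ (lose p∈ (F.orbit-sym o)))

      cover′ : ∀ z → Any (λ x → G.Orbit x z) xs ⊎ Any (λ p → G.Orbit (proj₁ p) z) ((x , y) ∷ ps)
      cover′ z with cover z
      ... | inj₁ (here o)    = inj₂ (here o)
      ... | inj₁ (there any) = inj₁ any
      ... | inj₂ any         = inj₂ (there any)

      num′ : ∀ {i} → i < n → count (λ y → cycLen f y ℕP.≟ suc i) (allFin n)
        ≡ (cycles xs (suc i) + count (λ p → cycLen g (proj₁ p) ℕP.≟ suc i) ((x , y) ∷ ps)) * suc i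
      num′ {i} i<n = trans (num i<n) (cong (_* suc i)
        (move (𝟙 (cycLen g x ℕP.≟ suc i)) (cycles xs (suc i)) _))
        where
        move : ∀ a b d → a + b + d ≡ b + (a + d)
        move = solve-∀

    assigned : count (λ y → cycLen f y ℕP.≟ c) ys ≡ count (λ p → cycLen g (proj₁ p) ℕP.≟ c) ps
    assigned = trans (∑-map proj₂ _ ps)
      (∑-cong-∈ ps (λ {p} p∈ → cong (λ l → 𝟙 (l ℕP.≟ c)) (sym (All.lookup len p∈))))

    total : count (λ y → cycLen f y ℕP.≟ c) (allFin n)
      ≡ (suc (cycles xs c) + count (λ p → cycLen g (proj₁ p) ℕP.≟ c) ps) * c
    total = trans at (cong
      (λ k → (k + cycles xs c + count (λ p → cycLen g (proj₁ p) ℕP.≟ c) ps) * c)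
      (𝟙-yes (c ℕP.≟ c) refl))
      where
      at : count (λ y → cycLen f y ℕP.≟ c) (allFin n)
        ≡ (cycles (x ∷ xs) c + count (λ p → cycLen g (proj₁ p) ℕP.≟ c) ps) * c
      at with i , c≡ , i<n ← length-index x =
        subst (λ d → count (λ y → cycLen f y ℕP.≟ d) (allFin n)
          ≡ (cycles (x ∷ xs) d + count (λ p → cycLen g (proj₁ p) ℕP.≟ d) ps) * d) (sym c≡) (num i<n)

    choices : count (F.free? ys c) (allFin n) ≡ suc (cycles xs c) * c
    -- The `k * c` points on taken cycles are added to both sides, where the invariant applies, and
    -- then cancelled.
    choices = ℕP.+-cancelʳ-≡ _ _ _ (begin
      count (F.free? ys c) (allFin n) + k * c
        ≡⟨ cong (λ j → count (F.free? ys c) (allFin n) + j * c) assigned ⟨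
      count (F.free? ys c) (allFin n) + count (λ y → cycLen f y ℕP.≟ c) ys * c
        ≡⟨ F.count-free ys c (AllPairsP.map⁺ (AllPairs.map (λ ¬o o → ¬o (inj₂ o)) sep)) ⟨
      count (λ y → cycLen f y ℕP.≟ c) (allFin n)
        ≡⟨ total ⟩
      (suc (cycles xs c) + k) * c
        ≡⟨ ℕP.*-distribʳ-+ c (suc (cycles xs c)) k ⟩
      suc (cycles xs c) * c + k * c ∎)
      where k = count (λ p → cycLen g (proj₁ p) ℕP.≟ c) ps

  -- If `x` has cycle length `suc j` and `m` cycles of that length follow, the factor of `j` grows
  -- from `m ! * suc j ^ m` to the same expression at `suc m`, that is by `suc m * suc j`, the
  -- factor of `x` in `weight`.
  weight-product : ∀ xs →
    weight xs ≡ product (map (λ i → cycles xs (suc i) ! * suc i ^ cycles xs (suc i)) (upTo n))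
  weight-product [] = sym (ones (upTo n))
    where
    ones : ∀ is → product (map (λ i → 1) is) ≡ 1
    ones []       = refl
    ones (i ∷ is) = trans (ℕP.*-identityˡ _) (ones is)
  weight-product (x ∷ xs) with j , c≡ , j<n ← length-index x = sym (begin
    product (map (factor (x ∷ xs)) (upTo n))
      ≡⟨ product-update (suc (cycles xs (suc j)) * suc j) (Unique.upTo⁺ n) (∈-upTo⁺ j<n) at off ⟩
    suc (cycles xs (suc j)) * suc j * product (map (factor xs) (upTo n))
      ≡⟨ cong₂ (λ d p → suc (cycles xs d) * d * p) (sym c≡) (sym (weight-product xs)) ⟩
    suc (cycles xs (cycLen g x)) * cycLen g x * weight xs ∎)
    where
    open ≡-Reasoning
    factor : List (Fin n) → ℕ → ℕ
    factor zs i = cycles zs (suc i) ! * suc i ^ cycles zs (suc i)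

    at : factor (x ∷ xs) j ≡ suc (cycles xs (suc j)) * suc j * factor xs j
    at = trans (cong (λ k → (k + m) ! * suc j ^ (k + m)) (𝟙-yes (cycLen g x ℕP.≟ suc j) c≡))
               (regroup (suc m) (m !) (suc j) (suc j ^ m))
      where
      m = cycles xs (suc j)
      regroup : ∀ a b d e → a * b * (d * e) ≡ a * d * (b * e)
      regroup = solve-∀

    off : ∀ {i} → i ≢ j → factor (x ∷ xs) i ≡ factor xs i
    off {i} i≢j = cong (λ k → (k + cycles xs (suc i)) ! * suc i ^ (k + cycles xs (suc i)))
      (𝟙-no (cycLen g x ℕP.≟ suc i) (λ c≡′ → i≢j (ℕP.suc-injective (trans (sym c≡′) c≡))))

  extensions-equal : (∀ {i} → i < n → numCycles f i ≡ numCycles g i) →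
    extensions [] ≡ product (map (λ i → numCycles f i ! * suc i ^ numCycles f i) (upTo n))
  extensions-equal same = trans
    (extensions-weight G.cycleReps [] [] [] G.cycleReps-separated (All.tabulate (λ _ → []))
      (λ z → inj₁ (G.cycleReps-cover z))
      (λ {i} i<n → trans (F.count-cycLen (suc i)) (cong (_* suc i)
        (trans (sym (F.numCycles-reps i)) (trans (counted i<n) (sym (ℕP.+-identityʳ _)))))))
    (trans (weight-product G.cycleReps) (cong product (map-cong-local
      (All.tabulate (λ {i} i∈ → cong (λ k → k ! * suc i ^ k) (sym (counted (∈-upTo⁻ i∈))))))))
    where
    counted : ∀ {i} → i < n → numCycles f i ≡ cycles G.cycleReps (suc i)
    counted {i} i<n = trans (same i<n) (G.numCycles-reps i)

count-conjugators : ∀ {n} (a b : Vec (Fin n) n) (a-perm : IsPermVec a) (b-perm : IsPermVec b) →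
  count (Conjugators.commutes? (lookup a) (lookup b) (a-perm _ _) (b-perm _ _)) (allPerms n) ≡ ψ a b
count-conjugators {n} a b a-perm b-perm
  rewrite sameCycleStructure≡agree (lookup a) (lookup b)
  with agree (lookup a) (lookup b) (upTo n) in eq
... | true  = trans (count-cong C.commutes? (C.extends? []) (allPerms n) (λ comm → comm , []) proj₁)
    (C.extensions-equal (λ i<n → All.lookup (agree-sound (lookup a) (lookup b) eq) (∈-upTo⁺ i<n)))
  where module C = Conjugators (lookup a) (lookup b) (a-perm _ _) (b-perm _ _)
... | false = count-none C.commutes? (allPerms n) (λ {w} w∈ comm → absurd
    (trans (sym eq) (agree-complete _ _ (C.commutes-numCycles w (allPerms-perm w∈) comm) (upTo n))))
  where
  module C = Conjugators (lookup a) (lookup b) (a-perm _ _) (b-perm _ _)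
  absurd : ¬ false ≡ true
  absurd ()

-- Orbits of the autotopism group

-- `T g v w` reads as `g` sending `v` to `w`. Each pair of a representative and a group element has
-- one image; sorted by image, the pairs ending at `w` are as many as the elements fixing `w`, which
-- is how orbit-stabilizer enters as a hypothesis.
burnside : ∀ {A X : Set} {T : A → X → X → Set} (T? : ∀ g v w → Dec (T g v w)) G Xs reps →
  (∀ {g v} → g ∈ G → v ∈ reps → count (T? g v) Xs ≡ 1) →
  (∀ {w} → w ∈ Xs → ∑ reps (λ r → count (λ g → T? g r w) G) ≡ count (λ g → T? g w w) G) →
  length reps * length G ≡ ∑ G (λ g → count (λ w → T? g w w) Xs)
burnside T? G Xs reps image stabilizer = begin
  length reps * length G
    ≡⟨ ∑-const (length G) reps ⟨
  ∑ reps (λ _ → length G)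
    ≡⟨ ∑-cong-∈ reps (λ r∈ → trans (trans (sym (ℕP.*-identityʳ _)) (sym (∑-const 1 G)))
                                   (sym (∑-cong-∈ G (λ g∈ → image g∈ r∈)))) ⟩
  ∑ reps (λ r → ∑ G (λ g → count (T? g r) Xs))
    ≡⟨ ∑-cong reps (λ r → ∑-swap _ G Xs) ⟩
  ∑ reps (λ r → ∑ Xs (λ w → count (λ g → T? g r w) G))
    ≡⟨ ∑-swap _ reps Xs ⟩
  ∑ Xs (λ w → ∑ reps (λ r → count (λ g → T? g r w) G))
    ≡⟨ ∑-cong-∈ Xs stabilizer ⟩
  ∑ Xs (λ w → count (λ g → T? g w w) G)
    ≡⟨ ∑-swap _ Xs G ⟩
  ∑ G (λ g → count (λ w → T? g w w) Xs) ∎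
  where open ≡-Reasoning

-- Permutations as vectors, and pairs of them

infixr 9 _⊙_

_⊙_ : ∀ {n} → Vec (Fin n) n → Vec (Fin n) n → Vec (Fin n) n
a ⊙ b = tabulate (λ i → lookup a (lookup b i))

lookup-⊙ : ∀ {n} (a b : Vec (Fin n) n) i → lookup (a ⊙ b) i ≡ lookup a (lookup b i)
lookup-⊙ a b = VecP.lookup∘tabulate _

⊙-perm : ∀ {n} (a b : Vec (Fin n) n) → IsPermVec a → IsPermVec b → IsPermVec (a ⊙ b)
⊙-perm a b a-perm b-perm i j eq =
  b-perm i j (a-perm _ _ (trans (sym (lookup-⊙ a b i)) (trans eq (lookup-⊙ a b j))))

-- The power of `a` used in `f⁻¹`, here without a proof of injectivity, so that `_⁻¹` is defined on
-- all pairs; it inverts `a` when `a` is a permutation.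
inv : ∀ {n} → Vec (Fin n) n → Vec (Fin n) n
inv a = tabulate (λ y → iter (lookup a) (pred (cycLen (lookup a) y)) y)

module _ {n} (a : Vec (Fin n) n) (a-perm : IsPermVec a) where

  private module A = Orbits (lookup a) (a-perm _ _)

  lookup-inv : ∀ y → lookup a (lookup (inv a) y) ≡ y
  lookup-inv y = trans (cong (lookup a) (VecP.lookup∘tabulate _ y)) (A.f∘f⁻¹ y)

  inv-lookup : ∀ x → lookup (inv a) (lookup a x) ≡ x
  inv-lookup x = a-perm _ _ (lookup-inv (lookup a x))

  inv-perm : IsPermVec (inv a)
  inv-perm x y eq = trans (sym (lookup-inv x)) (trans (cong (lookup a) eq) (lookup-inv y))

  ⊙-inv-cancel : ∀ b → (b ⊙ inv a) ⊙ a ≡ b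
  ⊙-inv-cancel b = lookup-ext λ i → trans (lookup-⊙ (b ⊙ inv a) a i)
    (trans (lookup-⊙ b (inv a) _) (cong (lookup b) (inv-lookup i)))

  ⊙-cancel-inv : ∀ b → (b ⊙ a) ⊙ inv a ≡ b
  ⊙-cancel-inv b = lookup-ext λ i → trans (lookup-⊙ (b ⊙ a) (inv a) i)
    (trans (lookup-⊙ b a _) (cong (lookup b) (lookup-inv i)))

  toPermutation : Permutation′ n
  toPermutation = permutation (lookup a) (lookup (inv a)) lookup-inv inv-lookup

permutation-injective : ∀ {n} (σ : Permutation′ n) {x y} → σ ⟨$⟩ʳ x ≡ σ ⟨$⟩ʳ y → x ≡ y
permutation-injective σ eq = trans (sym (inverseˡ σ)) (trans (cong (σ ⟨$⟩ˡ_) eq) (inverseˡ σ))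

fromPermutation-perm : ∀ {n} (σ : Permutation′ n) → IsPermVec (tabulate (σ ⟨$⟩ʳ_))
fromPermutation-perm σ i j eq = permutation-injective σ
  (trans (sym (VecP.lookup∘tabulate _ i)) (trans eq (VecP.lookup∘tabulate _ j)))

Isotopism : ℕ → Set
Isotopism n = Vec (Fin n) n × Vec (Fin n) n

_≟ᵢ_ : ∀ {n} → DecidableEquality (Isotopism n)
_≟ᵢ_ = ProductP.≡-dec (VecP.≡-dec _≟_) (VecP.≡-dec _≟_)

_·_ : ∀ {n} → Isotopism n → Isotopism n → Isotopism n
(a , b) · (c , d) = a ⊙ c , b ⊙ d

_⁻¹ : ∀ {n} → Isotopism n → Isotopism n
(a , b) ⁻¹ = inv a , inv b

-- w = α v β⁻¹, stated without the inverse.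
record Sends {n} (g : Isotopism n) (v w : Vec (Fin n) n) : Set where
  constructor sends
  field intertwines : ∀ i → lookup (proj₁ g) (lookup v i) ≡ lookup w (lookup (proj₂ g) i)
open Sends

sends? : ∀ {n} (g : Isotopism n) v w → Dec (Sends g v w)
sends? (a , b) v w = map′ sends intertwines (all? (λ i → lookup a (lookup v i) ≟ lookup w (lookup b i)))

sends-· : ∀ {n} {g h : Isotopism n} {u v w} → Sends h u v → Sends g v w → Sends (g · h) u w
sends-· {g = a , b} {c , d} {u} {v} {w} (sends h-sends) (sends g-sends) = sends λ i → begin
  lookup (a ⊙ c) (lookup u i)          ≡⟨ lookup-⊙ a c _ ⟩
  lookup a (lookup c (lookup u i))     ≡⟨ cong (lookup a) (h-sends i) ⟩
  lookup a (lookup v (lookup d i))     ≡⟨ g-sends _ ⟩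
  lookup w (lookup b (lookup d i))     ≡⟨ cong (lookup w) (lookup-⊙ b d i) ⟨
  lookup w (lookup (b ⊙ d) i)          ∎
  where open ≡-Reasoning

module Classes {n} (L : Square n) where

  Γ : List (Isotopism n)
  Γ = rrsAutotopisms L

  record _∈Γ (g : Isotopism n) : Set where
    constructor autotopism
    field
      α-perm : IsPermVec (proj₁ g)
      β-perm : IsPermVec (proj₂ g)
      maps   : IsAutotopism L (proj₁ g) (proj₂ g)
  open _∈Γ

  ∈Γ⁺ : ∀ {g} → g ∈Γ → g ∈ Γ
  ∈Γ⁺ g∈ = ∈-filter⁺ _ (∈-cartesianProduct⁺ (∈-allPerms _ (α-perm g∈)) (∈-allPerms _ (β-perm g∈))) (maps g∈)

  ∈Γ⁻ : ∀ {g} → g ∈ Γ → g ∈Γ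
  ∈Γ⁻ g∈
    with ∈-filter⁻ (λ p → isAutotopism? L (proj₁ p) (proj₂ p))
                   {xs = cartesianProduct (allPerms n) (allPerms n)} g∈
  ... | g∈× , maps with ∈-cartesianProduct⁻ (allPerms n) (allPerms n) g∈×
  ... | a∈ , b∈ = autotopism (allPerms-perm a∈) (allPerms-perm b∈) maps

  Γ-unique : Unique Γ
  Γ-unique = Unique.filter⁺ _ (Unique.cartesianProduct⁺ (allPerms-unique n) (allPerms-unique n))

  ·-∈Γ : ∀ {g h} → g ∈Γ → h ∈Γ → (g · h) ∈Γ
  ·-∈Γ {a , b} {c , d} g∈ h∈ = autotopism 
    (⊙-perm a c (α-perm g∈) (α-perm h∈)) (⊙-perm b d (β-perm g∈) (β-perm h∈)) λ r s → begin
    L (lookup (a ⊙ c) r) (lookup (a ⊙ c) s)                ≡⟨ cong₂ L (lookup-⊙ a c r) (lookup-⊙ a c s) ⟩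
    L (lookup a (lookup c r)) (lookup a (lookup c s))      ≡⟨ maps g∈ _ _ ⟩
    lookup b (L (lookup c r) (lookup c s))                 ≡⟨ cong (lookup b) (maps h∈ r s) ⟩
    lookup b (lookup d (L r s))                            ≡⟨ lookup-⊙ b d _ ⟨
    lookup (b ⊙ d) (L r s)                                 ∎
    where open ≡-Reasoning

  ⁻¹-∈Γ : ∀ {g} → g ∈Γ → (g ⁻¹) ∈Γ
  ⁻¹-∈Γ {a , b} g∈ = autotopism (inv-perm a (α-perm g∈)) (inv-perm b (β-perm g∈)) λ r s → begin
    L (a⁻¹ r) (a⁻¹ s)                                            ≡⟨ inv-lookup b (β-perm g∈) _ ⟨
    lookup (inv b) (lookup b (L (a⁻¹ r) (a⁻¹ s)))                ≡⟨ cong (lookup (inv b)) (maps g∈ _ _) ⟨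
    lookup (inv b) (L (lookup a (a⁻¹ r)) (lookup a (a⁻¹ s)))     ≡⟨ cong (lookup (inv b)) (cong₂ L (a∘a⁻¹ r) (a∘a⁻¹ s)) ⟩
    lookup (inv b) (L r s)                                       ∎
    where
    open ≡-Reasoning
    a⁻¹ = lookup (inv a)
    a∘a⁻¹ = lookup-inv a (α-perm g∈)

  sends-⁻¹ : ∀ {g} → g ∈Γ → ∀ {v w} → Sends g v w → Sends (g ⁻¹) w v
  sends-⁻¹ {a , b} g∈ {v} {w} (sends g-sends) = sends λ i → begin
    lookup (inv a) (lookup w i)
      ≡⟨ cong (λ j → lookup (inv a) (lookup w j)) (lookup-inv b (β-perm g∈) i) ⟨
    lookup (inv a) (lookup w (lookup b (lookup (inv b) i)))
      ≡⟨ cong (lookup (inv a)) (g-sends _) ⟨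
    lookup (inv a) (lookup a (lookup v (lookup (inv b) i)))
      ≡⟨ inv-lookup a (α-perm g∈) _ ⟩
    lookup v (lookup (inv b) i) ∎
    where open ≡-Reasoning

  sends-once : ∀ {g} v → g ∈Γ → IsPermVec v → count (sends? g v) (allPerms n) ≡ 1
  sends-once {a , b} v g∈ v-perm = count-unique (sends? (a , b) v) (allPerms-unique n)
    (∈-allPerms w (⊙-perm (a ⊙ v) (inv b) (⊙-perm a v (α-perm g∈) v-perm) (inv-perm b (β-perm g∈))))
    (sends λ i → sym (trans (lookup-⊙ (a ⊙ v) (inv b) _)
      (trans (cong (lookup (a ⊙ v)) (inv-lookup b (β-perm g∈) i)) (lookup-⊙ a v i))))
    (λ {u} (sends g-sends) → trans (sym (⊙-cancel-inv b (β-perm g∈) u))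
      (cong (_⊙ inv b) (lookup-ext {v = u ⊙ b} {a ⊙ v} (λ i →
        trans (lookup-⊙ u b i) (trans (sym (g-sends i)) (sym (lookup-⊙ a v i)))))))
    where w = (a ⊙ v) ⊙ inv b

  -- {g : g v = w} is the coset Stab(w) h.
  count-coset : ∀ {h v w} → h ∈Γ → Sends h v w →
                count (λ g → sends? g v w) Γ ≡ count (λ g → sends? g w w) Γ
  count-coset {h} {v} {w} h∈ h-sends = begin
    count v→w? Γ              ≡⟨ length-filter v→w? Γ ⟨
    length (filter v→w? Γ)    ≡⟨ length-bijection (λ g k → g ≟ᵢ (k · h)) _ _ right left ⟩
    length (filter w→w? Γ)    ≡⟨ length-filter w→w? Γ ⟩
    count w→w? Γ              ∎
    where
    open ≡-Reasoning
    v→w? = λ g → sends? g v w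
    w→w? = λ g → sends? g w w

    ·-⁻¹ : ∀ k → (k · h) · (h ⁻¹) ≡ k
    ·-⁻¹ (a , b) = cong₂ _,_ (⊙-cancel-inv (proj₁ h) (α-perm h∈) a) (⊙-cancel-inv (proj₂ h) (β-perm h∈) b)

    ⁻¹-· : ∀ g → (g · (h ⁻¹)) · h ≡ g
    ⁻¹-· (a , b) = cong₂ _,_ (⊙-inv-cancel (proj₁ h) (α-perm h∈) a) (⊙-inv-cancel (proj₂ h) (β-perm h∈) b)

    right : ∀ {g} → g ∈ filter v→w? Γ → count (λ k → g ≟ᵢ (k · h)) (filter w→w? Γ) ≡ 1
    right {g} g∈ with ∈-filter⁻ v→w? {xs = Γ} g∈
    ... | g∈Γ , g-sends = count-unique _ (Unique.filter⁺ w→w? Γ-unique)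
      (∈-filter⁺ w→w? (∈Γ⁺ (·-∈Γ (∈Γ⁻ g∈Γ) (⁻¹-∈Γ h∈)))
        (sends-· (sends-⁻¹ h∈ h-sends) g-sends))
      (sym (⁻¹-· g))
      (λ {k} eq → trans (sym (·-⁻¹ k)) (cong (_· (h ⁻¹)) (sym eq)))

    left : ∀ {k} → k ∈ filter w→w? Γ → count (λ g → g ≟ᵢ (k · h)) (filter v→w? Γ) ≡ 1
    left {k} k∈ with ∈-filter⁻ w→w? {xs = Γ} k∈
    ... | k∈Γ , k-sends = count-unique (_≟ᵢ (k · h)) (Unique.filter⁺ v→w? Γ-unique)
      (∈-filter⁺ v→w? (∈Γ⁺ (·-∈Γ (∈Γ⁻ k∈Γ) h∈)) (sends-· h-sends k-sends)) refl (λ eq → eq)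

  Orbit : Vec (Fin n) n → Vec (Fin n) n → Set
  Orbit v w = Any (λ g → Sends g v w) Γ

  orbit? : ∀ v w → Dec (Orbit v w)
  orbit? v w = Any.any? (λ g → sends? g v w) Γ

  orbit-refl : ∀ v → Orbit v v
  orbit-refl v = lose (∈Γ⁺ {e , e} (autotopism e-perm e-perm e-maps))
    (sends λ i → trans (lookup-e _) (cong (lookup v) (sym (lookup-e i))))
    where
    e = tabulate (λ i → i)
    lookup-e = VecP.lookup∘tabulate {n = n} (λ i → i)
    e-perm : IsPermVec e
    e-perm i j eq = trans (sym (lookup-e i)) (trans eq (lookup-e j))
    e-maps : IsAutotopism L e e
    e-maps r c = trans (cong₂ L (lookup-e r) (lookup-e c)) (sym (lookup-e _))

  orbit-sym : ∀ {v w} → Orbit v w → Orbit w v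
  orbit-sym o with find o
  ... | g , g∈ , g-sends = lose (∈Γ⁺ (⁻¹-∈Γ (∈Γ⁻ g∈))) (sends-⁻¹ (∈Γ⁻ g∈) g-sends)

  orbit-trans : ∀ {u v w} → Orbit u v → Orbit v w → Orbit u w
  orbit-trans o p with find o | find p
  ... | h , h∈ , h-sends | g , g∈ , g-sends =
    lose (∈Γ⁺ (·-∈Γ (∈Γ⁻ g∈) (∈Γ⁻ h∈))) (sends-· h-sends g-sends)

  open Representatives orbit?

  orbitReps : List (Vec (Fin n) n)
  orbitReps = reps (allPerms n)

  orbitReps-perm : ∀ v → v ∈ orbitReps → IsPermVec v
  orbitReps-perm v v∈ = allPerms-perm (reps-⊆ v∈)

  -- Exactly one representative lies in the orbit of `w`. The elements sending it to `w` form a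
  -- coset of the stabilizer of `w`; the other representatives contribute nothing.
  stabilizer : ∀ {w} → w ∈ allPerms n →
    ∑ orbitReps (λ r → count (λ g → sends? g r w) Γ) ≡ count (λ g → sends? g w w) Γ
  stabilizer {w} w∈ = begin
    ∑ orbitReps (λ r → count (λ g → sends? g r w) Γ)   ≡⟨ ∑-cong orbitReps coset ⟩
    ∑ orbitReps (λ r → 𝟙 (orbit? r w) * stab)          ≡⟨ ∑-* _ stab orbitReps ⟩
    count (λ r → orbit? r w) orbitReps * stab          ≡⟨ cong (_* stab) one-rep ⟩
    1 * stab                                           ≡⟨ ℕP.*-identityˡ stab ⟩
    stab                                               ∎
    where
    open ≡-Reasoning
    stab = count (λ g → sends? g w w) Γ

    one-rep : count (λ r → orbit? r w) orbitReps ≡ 1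
    one-rep = count-exclusive (λ r → orbit? r w)
      (AllPairs.map (λ ¬o o p → ¬o (orbit-trans o (orbit-sym p))) (reps-separated (allPerms n)))
      (Any.map orbit-sym (reps-cover orbit-refl w∈))

    coset : ∀ r → count (λ g → sends? g r w) Γ ≡ 𝟙 (orbit? r w) * stab
    coset r with orbit? r w
    ... | no  ¬o = count-none (λ g → sends? g r w) Γ (λ g∈ g-sends → ¬o (lose g∈ g-sends))
    ... | yes o with find o
    ... | h , h∈ , h-sends = trans (count-coset (∈Γ⁻ h∈) h-sends) (sym (ℕP.*-identityˡ stab))

  orbit-count : length orbitReps * length Γ ≡ ∑ Γ (λ g → ψ (proj₁ g) (proj₂ g))
  orbit-count = trans
    (burnside sends? Γ (allPerms n) orbitReps
      (λ {_} {v} g∈ v∈ → sends-once v (∈Γ⁻ g∈) (orbitReps-perm v v∈)) stabilizer)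
    (∑-cong-∈ Γ (λ {g} g∈ → trans
      -- Being fixed by `g` is literally the commuting condition counted by `count-conjugators`.
      (count-cong (λ w → sends? g w w) _ (allPerms n) intertwines sends)
      (count-conjugators (proj₁ g) (proj₂ g) (α-perm (∈Γ⁻ g∈)) (β-perm (∈Γ⁻ g∈)))))

  -- Isomorphism between relabellings of the symbols of L

  relabel : Vec (Fin n) n → Square n
  relabel v r c = lookup v (L r c)

  relabel-latin : ∀ v → IsPermVec v → IsLatin L → IsLatin (relabel v)
  relabel-latin v v-perm (rows , columns) =
    (λ r c₁ c₂ eq → rows r c₁ c₂ (v-perm _ _ eq)) , (λ c r₁ r₂ eq → columns c r₁ r₂ (v-perm _ _ eq))

  isomorphic⇒orbit : ∀ v w → IsPermVec v → IsPermVec w → Isomorphic (relabel v) (relabel w) → Orbit v w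
  isomorphic⇒orbit v w v-perm w-perm (σ , iso) = lose (∈Γ⁺ (autotopism a-perm b-perm auto)) a-b-sends
    where
    open ≡-Reasoning
    a = tabulate (σ ⟨$⟩ʳ_)
    -- The only symbol permutation that `iso` allows, found by cancelling `w` on the left.
    b = inv w ⊙ (a ⊙ v)
    a-perm = fromPermutation-perm σ
    b-perm : IsPermVec b
    b-perm = ⊙-perm (inv w) (a ⊙ v) (inv-perm w w-perm) (⊙-perm a v a-perm v-perm)
    lookup-a = VecP.lookup∘tabulate (σ ⟨$⟩ʳ_)

    lookup-b : ∀ i → lookup b i ≡ lookup (inv w) (lookup a (lookup v i))
    lookup-b i = trans (lookup-⊙ (inv w) (a ⊙ v) i) (cong (lookup (inv w)) (lookup-⊙ a v i))

    auto : IsAutotopism L a b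
    auto r c = begin
      L (lookup a r) (lookup a c)                               ≡⟨ cong₂ L (lookup-a r) (lookup-a c) ⟩
      L (σ ⟨$⟩ʳ r) (σ ⟨$⟩ʳ c)                                   ≡⟨ inv-lookup w w-perm _ ⟨
      lookup (inv w) (relabel w (σ ⟨$⟩ʳ r) (σ ⟨$⟩ʳ c))          ≡⟨ cong (lookup (inv w)) (iso r c) ⟩
      lookup (inv w) (σ ⟨$⟩ʳ relabel v r c)                     ≡⟨ cong (lookup (inv w)) (lookup-a _) ⟨
      lookup (inv w) (lookup a (relabel v r c))                 ≡⟨ lookup-b (L r c) ⟨
      lookup b (L r c)                                          ∎

    a-b-sends : Sends (a , b) v w
    a-b-sends = sends λ i → sym (trans (cong (lookup w) (lookup-b i)) (lookup-inv w w-perm _))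

  -- Undoing α on rows, columns and symbols of `M` is an isomorphism. It restores the rows and
  -- columns of `L` and leaves the symbols relabelled by γ followed by the inverse of α. The row
  -- part `a` of an element of Γ sending this relabelling to `w` completes the isomorphism.
  orbit⇒isomorphic : ∀ {M} ((α , γ , _) : RRSIsotopic L M) {w} →
    Orbit (tabulate (λ i → α ⟨$⟩ˡ (γ ⟨$⟩ʳ i))) w → Isomorphic M (relabel w)
  orbit⇒isomorphic {M} (α , γ , iso) {w} o with find o
  ... | (a , b) , g∈ , sends g-sends = flip α ∘ₚ toPermutation a (α-perm (∈Γ⁻ g∈)) , λ r c → begin
    lookup w (L (lookup a (α ⟨$⟩ˡ r)) (lookup a (α ⟨$⟩ˡ c)))
      ≡⟨ cong (lookup w) (maps (∈Γ⁻ g∈) _ _) ⟩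
    lookup w (lookup b (L (α ⟨$⟩ˡ r) (α ⟨$⟩ˡ c)))
      ≡⟨ g-sends _ ⟨
    lookup a (lookup v (L (α ⟨$⟩ˡ r) (α ⟨$⟩ˡ c)))
      ≡⟨ cong (lookup a) (VecP.lookup∘tabulate _ (L (α ⟨$⟩ˡ r) (α ⟨$⟩ˡ c))) ⟩
    lookup a (α ⟨$⟩ˡ (γ ⟨$⟩ʳ L (α ⟨$⟩ˡ r) (α ⟨$⟩ˡ c)))
      ≡⟨ cong (λ s → lookup a (α ⟨$⟩ˡ s)) (iso _ _) ⟨
    lookup a (α ⟨$⟩ˡ M (α ⟨$⟩ʳ (α ⟨$⟩ˡ r)) (α ⟨$⟩ʳ (α ⟨$⟩ˡ c)))
      ≡⟨ cong (λ s → lookup a (α ⟨$⟩ˡ s)) (cong₂ M (inverseʳ α) (inverseʳ α)) ⟩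
    lookup a (α ⟨$⟩ˡ M r c) ∎
    where
    open ≡-Reasoning
    v = tabulate (λ i → α ⟨$⟩ˡ (γ ⟨$⟩ʳ i))

  classReps : List (Square n)
  classReps = map relabel orbitReps

  classReps-reps : IsLatin L → IsSymmetric L → IsClassReps L classReps
  classReps-reps latin symm =
    AllP.map⁺ (All.tabulate (λ {v} v∈ →
      relabel-latin v (orbitReps-perm v v∈) latin ,
      (λ r c → cong (lookup v) (symm r c)) ,
      Permutation.id , toPermutation v (orbitReps-perm v v∈) , λ _ _ → refl)) ,
    AllPairsP.map⁺ (nonisomorphic orbitReps-perm (reps-separated (allPerms n))) ,
    λ M _ _ iso@(α , γ , _) → AnyP.map⁺ (Any.map (orbit⇒isomorphic iso)
      (reps-cover orbit-refl (∈-allPerms _ (fromPermutation-perm (γ ∘ₚ flip α)))))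
    where
    nonisomorphic : ∀ {vs} → (∀ v → v ∈ vs → IsPermVec v) → AllPairs (λ v w → ¬ Orbit v w) vs →
                    AllPairs (λ v w → ¬ Isomorphic (relabel v) (relabel w)) vs
    nonisomorphic perm []         = []
    nonisomorphic perm (¬os ∷ sep) =
      All.tabulate (λ w∈ iso → All.lookup ¬os w∈
        (isomorphic⇒orbit _ _ (perm _ (here refl)) (perm _ (there w∈)) iso))
      ∷ nonisomorphic (λ v v∈ → perm v (there v∈)) sep

theorem5 : (n : ℕ) (L : Square n) → IsLatin L → IsSymmetric L →
    Σ (List (Square n)) λ reps →
    IsClassReps L reps ×
    length reps * length (rrsAutotopisms L)
    ≡ sum (map (λ p → ψ (proj₁ p) (proj₂ p)) (rrsAutotopisms L))
theorem5 n L latin symm =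
  classReps , classReps-reps latin symm ,
  trans (cong (_* length (rrsAutotopisms L)) (length-map relabel orbitReps)) orbit-count
  where open Classes L
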